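{- Let $K$ be the $2$-adic integer such that, for all positive integers $d$ and all integers $e>d$, $$\operatorname{uns}(e,d)+K\equiv \operatorname{stab}(e+1,d)\pmod{2^d}.$$ Then $K=-zw$.
   Context: For a positive integer $n$, $\nu(n)$ is the exponent of $2$ in the prime factorization of $n$, and $\operatorname{od}(n)=n/2^{\nu(n)}$ is the odd part of $n$. The notation $2^e!$ means $(2^e)!$, and $(2^e-1)!!$ is the product of all odd positive integers less than $2^e$. $z$ is the $2$-adic integer $\lim_{e\to\infty}\operatorname{od}(2^e!)$ ($2$-adic limit); it is known to exist and to satisfy $z\equiv\operatorname{od}(2^{e-1}!)\pmod{2^e}$ for all $e\ge3$. $w$ is the $2$-adic integer satisfying $w\equiv\frac{(2^e-1)!!-1}{2^e}\pmod{2^{e-1}}$ for all $e\ge3$ (these fractions are integers for $e\ge 3$, and consecutive ones, for $e$ and $e+1$, are congruent mod $2^{e-1}$, so $w$ is well defined). The bit in position $i$ of a ($2$-adic) integer is the coefficient of $2^i$ in its binary expansion. $\operatorname{uns}(e,d)=\sum_{i=0}^{d-1}u_i2^i$, where $u_i$ is the bit of $\operatorname{od}(2^e!)$ in position $e+1+i$. $\operatorname{stab}(e+1,d)=\sum_{i=0}^{d-1}s_i2^i$, where $s_i$ is the bit of $z$ in position $e+1+i$. It is part of the paper's results that a $2$-adic integer $K$ with the stated property exists. -}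

module Defs where

open import Data.Nat.Base as ℕ using (ℕ; zero; suc; NonZero; _≤_; _!)
open import Data.Nat.Properties as ℕ using (m^n≢0; _!≢0)
open import Data.Nat.Divisibility using (_∣?_)
open import Data.Nat.DivMod using (_/_; _%_)
open import Data.Nat.ListAction using (sum; product)
open import Data.Nat.Primality.Factorisation using (factors; factorise)
open import Data.Integer.Base as ℤ using (ℤ; +_)
open import Data.Integer.DivMod using (_%ℕ_)
open import Data.Integer.Divisibility.Signed
  using (_∣_; divides; ∣m∣n⇒∣m+n; ∣m⇒∣-m; ∣n⇒∣m*n)
open import Data.Integer.Solver using (module +-*-Solver)
open import Data.List.Base using (length; filter; map; upTo)
open import Data.Product.Base using (∃-syntax)
open import Relation.Nullary.Decidable using (¬?)
open import Relation.Binary.PropositionalEquality using (_≡_; refl; subst)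

open +-*-Solver using (solve; _:+_; _:*_; :-_; _:-_; _:=_)

------------------------------------------------------------------------
-- 2-adic integers

infix 4 _≡ℤ_mod2^_ _≡_mod2^_ _≈_
infixl 6 _+_
infixl 7 _*_
infix 8 -_

_≡ℤ_mod2^_ : ℤ → ℤ → ℕ → Set
a ≡ℤ b mod2^ n = + (2 ℕ.^ n) ∣ (a ℤ.- b)

-- The inverse limit of the rings ℤ/2ⁿ: the n-th component is given by an
-- arbitrary integer representative, so equality is _≈_ below, not _≡_.
record ℤ₂ : Set where
  field
    approx   : ℕ → ℤ
    coherent : ∀ n → approx (suc n) ≡ℤ approx n mod2^ n

open ℤ₂ public

_≡_mod2^_ : ℤ₂ → ℤ₂ → ℕ → Set
x ≡ y mod2^ n = approx x n ≡ℤ approx y n mod2^ n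

_≈_ : ℤ₂ → ℤ₂ → Set
x ≈ y = ∀ n → x ≡ y mod2^ n

fromℕ : ℕ → ℤ₂
fromℕ m = record
  { approx   = λ _ → + m
  ; coherent = λ n → divides (+ 0)
      (solve 1 (λ a → a :- a := +-*-Solver.con (+ 0)) refl (+ m))
  }

_+_ : ℤ₂ → ℤ₂ → ℤ₂
x + y = record
  { approx   = λ n → approx x n ℤ.+ approx y n
  ; coherent = λ n → subst (_ ∣_)
      (solve 4 (λ a b c d → (a :- b) :+ (c :- d) := (a :+ c) :- (b :+ d)) refl
        (approx x (suc n)) (approx x n) (approx y (suc n)) (approx y n))
      (∣m∣n⇒∣m+n (coherent x n) (coherent y n))
  }

_*_ : ℤ₂ → ℤ₂ → ℤ₂
x * y = record
  { approx   = λ n → approx x n ℤ.* approx y n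
  ; coherent = λ n → subst (_ ∣_)
      (solve 4 (λ a b c d → c :* (a :- b) :+ b :* (c :- d) := a :* c :- b :* d) refl
        (approx x (suc n)) (approx x n) (approx y (suc n)) (approx y n))
      (∣m∣n⇒∣m+n
        (∣n⇒∣m*n (approx y (suc n)) (coherent x n))
        (∣n⇒∣m*n (approx x n) (coherent y n)))
  }

-_ : ℤ₂ → ℤ₂
- x = record
  { approx   = λ n → ℤ.- approx x n
  ; coherent = λ n → subst (_ ∣_)
      (solve 2 (λ a b → :- (a :- b) := (:- a) :- (:- b)) refl
        (approx x (suc n)) (approx x n))
      (∣m⇒∣-m (coherent x n))
  }

IsLimit : (ℕ → ℕ) → ℤ₂ → Set
IsLimit a x = ∀ n → ∃[ N ] (∀ e → N ≤ e → fromℕ (a e) ≡ x mod2^ n)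

------------------------------------------------------------------------
-- Binary digits

bitℕ : ℕ → ℕ → ℕ
bitℕ i m = (m / 2 ℕ.^ i) % 2
  where instance _ = m^n≢0 2 i

residue : ℤ₂ → ℕ → ℕ
residue x n = approx x n %ℕ (2 ℕ.^ n)
  where instance _ = m^n≢0 2 n

-- Positions 0,…,i of the expansion of x are those of its residue modulo 2^(i+1).
bit : ℕ → ℤ₂ → ℕ
bit i x = bitℕ i (residue x (suc i))

------------------------------------------------------------------------
-- Odd parts, factorials, and the quantities z, w, uns, stab

ν : (n : ℕ) .{{_ : NonZero n}} → ℕ
ν n = length (filter (2 ℕ.≟_) (factors (factorise n)))

od : (n : ℕ) .{{_ : NonZero n}} → ℕ
od n = n / 2 ℕ.^ ν n
  where instance _ = m^n≢0 2 (ν n)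

od[2^_!] : ℕ → ℕ
od[2^ e !] = od ((2 ℕ.^ e) !) {{(2 ℕ.^ e) !≢0}}

[2^_-1]!! : ℕ → ℕ
[2^ e -1]!! = product (filter (λ k → ¬? (2 ∣? k)) (upTo (2 ℕ.^ e)))

Is-z : ℤ₂ → Set
Is-z z = IsLimit od[2^_!] z

-- For e ≥ 3 the division below is exact, and the double factorial is positive,
-- so neither _/_ nor _∸_ truncates.
Is-w : ℤ₂ → Set
Is-w w = ∀ e → 3 ≤ e →
         w ≡ fromℕ (_/_ ([2^ e -1]!! ℕ.∸ 1) (2 ℕ.^ e) {{m^n≢0 2 e}}) mod2^ (e ℕ.∸ 1)

uns : ℕ → ℕ → ℕ
uns e d = sum (map (λ i → bitℕ (e ℕ.+ 1 ℕ.+ i) od[2^ e !] ℕ.* 2 ℕ.^ i) (upTo d))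

-- z is a parameter; the first index k is the position of the lowest bit read.
stab : ℤ₂ → ℕ → ℕ → ℕ
stab z k d = sum (map (λ i → bit (k ℕ.+ i) z ℕ.* 2 ℕ.^ i) (upTo d))

{-# OPTIONS --safe #-}

-- Write a_e = od(2^e!) and (2^e − 1)!! = 1 + 2^e w_e. Then a_{e+1} = a_e (1 + 2^{e+1} w_{e+1}),
-- so, since w_{f+1} ≡ w modulo 2^f, the product a_f (1 − 2^{f+1} w) does not depend on f ≥ e
-- modulo 2^{2e+1}: the factor (1 + 2^{f+1} w)(1 − 2^{f+2} w) is 1 − 2^{f+1} w up to 2^{2f+3}.
-- It tends to z, whence z ≡ a_e (1 − 2^{e+1} w) modulo 2^{2e+1}. In particular z and a_e
-- agree below position e + 1, and comparing the digits from there on gives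
-- stab − uns ≡ − a_e w ≡ − z w modulo 2^d for d < e.
module Submission where

open import Data.Nat.Base as ℕ using (ℕ; zero; suc; _<_; _≤_; NonZero; s≤s; z≤n; _!)
  renaming (_+_ to _+ℕ_; _*_ to _*ℕ_)
import Data.Nat.Properties as ℕ
import Data.Nat.Divisibility as ℕ∣
import Data.Nat.DivMod as ℕ
open import Data.Nat.ListAction using (sum; product)
open import Data.Nat.ListAction.Properties using (sum-++; product-++)
open import Data.Nat.Primality
  using (Prime; prime[2]; euclidsLemma; prime⇒irreducible)
open import Data.Nat.Primality.Factorisation using (factorise; module PrimeFactorisation)
import Data.Nat.Solver as ℕSolver
open import Data.Integer.Base as ℤ using (ℤ; +_)
import Data.Integer.Properties as ℤ
import Data.Integer.DivMod as ℤ
open import Data.Integer.Divisibility.Signed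
  using (divides; ∣⇒∣ᵤ; ∣m∣n⇒∣m+n; ∣m⇒∣-m; ∣-trans; ∣m⇒∣m*n; *-cancelˡ-∣)
  renaming (_∣_ to _∣ℤ_)
open import Data.Integer.Solver using (module +-*-Solver)
open import Data.List.Base using ([]; _∷_; length; filter; map; upTo; _++_)
open import Data.List.Properties
  using (upTo-∷ʳ; filter-++; filter-accept; filter-reject; map-++)
open import Data.List.Relation.Unary.All using (All; []; _∷_)
open import Data.Product.Base using (∃-syntax; _×_; _,_)
open import Data.Sum.Base using (inj₂; [_,_]′)
open import Relation.Nullary using (¬_; yes; no; contradiction)
open import Relation.Nullary.Decidable using (¬?)
open import Relation.Binary.PropositionalEquality
open import Defs

open ≡-Reasoning

-- Odd parts

2∤m*n : ∀ {m n} → ¬ 2 ℕ∣.∣ m → ¬ 2 ℕ∣.∣ n → ¬ 2 ℕ∣.∣ m *ℕ n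
2∤m*n {m} {n} 2∤m 2∤n 2∣mn = [ 2∤m , 2∤n ]′ (euclidsLemma m n prime[2] 2∣mn)

2∤1+2n : ∀ n → ¬ 2 ℕ∣.∣ suc (2 *ℕ n)
2∤1+2n n 2∣1+2n =
  2∤1 (ℕ∣.∣m+n∣m⇒∣n (subst (2 ℕ∣.∣_) (ℕ.+-comm 1 (2 *ℕ n)) 2∣1+2n) (ℕ∣.m∣m*n n))
  where
  2∤1 : ¬ 2 ℕ∣.∣ 1
  2∤1 2∣1 with () ← ℕ∣.∣1⇒≡1 2∣1

-- A factor 2 is cancelled on both sides at each step; if one exponent ran out first, the odd number
-- on that side would be even. This is the uniqueness of the odd part.
2^a*m≡2^b*n⇒m≡n : ∀ a b {m n} → ¬ 2 ℕ∣.∣ m → ¬ 2 ℕ∣.∣ n →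
                   2 ℕ.^ a *ℕ m ≡ 2 ℕ.^ b *ℕ n → m ≡ n
2^a*m≡2^b*n⇒m≡n zero zero {m} {n} _ _ eq =
  trans (sym (ℕ.*-identityˡ m)) (trans eq (ℕ.*-identityˡ n))
2^a*m≡2^b*n⇒m≡n zero (suc b) {m} {n} 2∤m _ eq = contradiction
  (subst (2 ℕ∣.∣_) (trans (sym eq) (ℕ.*-identityˡ m)) (ℕ∣.∣m⇒∣m*n n (ℕ∣.m∣m*n (2 ℕ.^ b)))) 2∤m
2^a*m≡2^b*n⇒m≡n (suc a) zero {m} {n} _ 2∤n eq = contradiction
  (subst (2 ℕ∣.∣_) (trans eq (ℕ.*-identityˡ n)) (ℕ∣.∣m⇒∣m*n m (ℕ∣.m∣m*n (2 ℕ.^ a)))) 2∤n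
2^a*m≡2^b*n⇒m≡n (suc a) (suc b) {m} {n} 2∤m 2∤n eq = 2^a*m≡2^b*n⇒m≡n a b 2∤m 2∤n
  (ℕ.*-cancelˡ-≡ _ _ 2 (begin
    2 *ℕ (2 ℕ.^ a *ℕ m) ≡⟨ ℕ.*-assoc 2 (2 ℕ.^ a) m ⟨
    2 ℕ.^ suc a *ℕ m    ≡⟨ eq ⟩
    2 ℕ.^ suc b *ℕ n    ≡⟨ ℕ.*-assoc 2 (2 ℕ.^ b) n ⟩
    2 *ℕ (2 ℕ.^ b *ℕ n) ∎))

prime≢2⇒2∤ : ∀ {p} → Prime p → 2 ≢ p → ¬ 2 ℕ∣.∣ p
prime≢2⇒2∤ p-prime 2≢p 2∣p with prime⇒irreducible p-prime 2∣p
... | inj₂ 2≡p = 2≢p 2≡p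

-- Every 2 in the list goes into the power; the remaining primes are odd, and by Euclid's lemma so
-- is their product. The exponent has the form in which `ν` counts it.
product-primes : ∀ {ps} → All Prime ps →
  ∃[ m ] (¬ 2 ℕ∣.∣ m) × product ps ≡ 2 ℕ.^ length (filter (2 ℕ.≟_) ps) *ℕ m
product-primes [] = 1 , 2∤1+2n 0 , refl
product-primes {p ∷ ps} (p-prime ∷ primes) with product-primes primes | 2 ℕ.≟ p
... | m , 2∤m , eq | yes refl = m , 2∤m , (begin
  2 *ℕ product ps
    ≡⟨ cong (2 *ℕ_) eq ⟩
  2 *ℕ (2 ℕ.^ length (filter (2 ℕ.≟_) ps) *ℕ m)
    ≡⟨ ℕ.*-assoc 2 (2 ℕ.^ length (filter (2 ℕ.≟_) ps)) m ⟨
  2 ℕ.^ suc (length (filter (2 ℕ.≟_) ps)) *ℕ m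
    ≡⟨ cong (λ l → 2 ℕ.^ length l *ℕ m) (filter-accept (2 ℕ.≟_) {xs = ps} refl) ⟨
  2 ℕ.^ length (filter (2 ℕ.≟_) (2 ∷ ps)) *ℕ m
    ∎)
... | m , 2∤m , eq | no 2≢p = p *ℕ m , 2∤m*n (prime≢2⇒2∤ p-prime 2≢p) 2∤m , (begin
  p *ℕ product ps
    ≡⟨ cong (p *ℕ_) eq ⟩
  p *ℕ (2 ℕ.^ length (filter (2 ℕ.≟_) ps) *ℕ m)
    ≡⟨ solve 3 (λ x y z → x :* (y :* z) := y :* (x :* z)) refl
         p (2 ℕ.^ length (filter (2 ℕ.≟_) ps)) m ⟩
  2 ℕ.^ length (filter (2 ℕ.≟_) ps) *ℕ (p *ℕ m)
    ≡⟨ cong (λ l → 2 ℕ.^ length l *ℕ (p *ℕ m)) (filter-reject (2 ℕ.≟_) {xs = ps} 2≢p) ⟨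
  2 ℕ.^ length (filter (2 ℕ.≟_) (p ∷ ps)) *ℕ (p *ℕ m)
    ∎)
  where open ℕSolver.+-*-Solver

od-spec : ∀ n .{{_ : NonZero n}} → (¬ 2 ℕ∣.∣ od n) × n ≡ 2 ℕ.^ ν n *ℕ od n
od-spec n = spec (product-primes (factorsPrime (factorise n)))
  where
  open PrimeFactorisation
  instance _ = ℕ.m^n≢0 2 (ν n)
  spec : (∃[ m ] (¬ 2 ℕ∣.∣ m) ×
           product (PrimeFactorisation.factors (factorise n)) ≡ 2 ℕ.^ ν n *ℕ m) →
         (¬ 2 ℕ∣.∣ od n) × n ≡ 2 ℕ.^ ν n *ℕ od n
  spec (m , 2∤m , eq) =
    subst (λ k → ¬ 2 ℕ∣.∣ k) (sym od≡m) 2∤m , trans n≡ (cong (2 ℕ.^ ν n *ℕ_) (sym od≡m))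
    where
    n≡ : n ≡ 2 ℕ.^ ν n *ℕ m
    n≡ = trans (isFactorisation (factorise n)) eq
    od≡m : od n ≡ m
    od≡m = begin
      n ℕ./ 2 ℕ.^ ν n                 ≡⟨ ℕ./-congˡ {o = 2 ℕ.^ ν n} (trans n≡ (ℕ.*-comm (2 ℕ.^ ν n) m)) ⟩
      (m *ℕ 2 ℕ.^ ν n) ℕ./ 2 ℕ.^ ν n ≡⟨ ℕ.m*n/n≡m m (2 ℕ.^ ν n) ⟩
      m                                 ∎

-- Any splitting into a power of 2 and an odd number determines `od`, so the exponent `ν` of a
-- factorial never has to be computed.
od-unique : ∀ n .{{_ : NonZero n}} a {m} → ¬ 2 ℕ∣.∣ m → n ≡ 2 ℕ.^ a *ℕ m → od n ≡ m
od-unique n a 2∤m n≡ with od-spec n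
... | 2∤od , n≡od = 2^a*m≡2^b*n⇒m≡n (ν n) a 2∤od 2∤m (trans (sym n≡od) n≡)

-- Double factorials

-- An arbitrary bound permits induction in steps of one; at `2 ℕ.^ e` this is `[2^ e -1]!!` by
-- definition.
∏odd<_ : ℕ → ℕ
∏odd< n = product (filter (λ k → ¬? (2 ℕ∣.∣? k)) (upTo n))

∏odd<-suc : ∀ n → ∏odd< suc n ≡ ∏odd< n *ℕ product (filter (λ k → ¬? (2 ℕ∣.∣? k)) (n ∷ []))
∏odd<-suc n = begin
  ∏odd< suc n                          ≡⟨ cong (λ l → product (filter odd? l)) (upTo-∷ʳ n) ⟨
  product (filter odd? (upTo n ++ n ∷ [])) ≡⟨ cong product (filter-++ odd? (upTo n) (n ∷ [])) ⟩
  product (filter odd? (upTo n) ++ filter odd? (n ∷ [])) ≡⟨ product-++ (filter odd? (upTo n)) _ ⟩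
  ∏odd< n *ℕ product (filter odd? (n ∷ [])) ∎
  where odd? = λ k → ¬? (2 ℕ∣.∣? k)

∏odd<-suc-odd : ∀ {n} → ¬ 2 ℕ∣.∣ n → ∏odd< suc n ≡ ∏odd< n *ℕ n
∏odd<-suc-odd {n} 2∤n = trans (∏odd<-suc n) (cong (∏odd< n *ℕ_)
  (trans (cong product (filter-accept (λ k → ¬? (2 ℕ∣.∣? k)) 2∤n)) (ℕ.*-identityʳ n)))

∏odd<-suc-even : ∀ {n} → 2 ℕ∣.∣ n → ∏odd< suc n ≡ ∏odd< n
∏odd<-suc-even {n} 2∣n = trans (∏odd<-suc n) (trans (cong (∏odd< n *ℕ_)
  (cong product (filter-reject (λ k → ¬? (2 ℕ∣.∣? k)) (λ 2∤n → 2∤n 2∣n)))) (ℕ.*-identityʳ _))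

∏odd<-2*suc : ∀ n → ∏odd< (2 *ℕ suc n) ≡ ∏odd< (2 *ℕ n) *ℕ suc (2 *ℕ n)
∏odd<-2*suc n = begin
  ∏odd< (2 *ℕ suc n)             ≡⟨ cong ∏odd<_ (ℕ.*-suc 2 n) ⟩
  ∏odd< suc (suc (2 *ℕ n))       ≡⟨ ∏odd<-suc-odd (2∤1+2n n) ⟩
  ∏odd< suc (2 *ℕ n) *ℕ suc (2 *ℕ n) ≡⟨ cong (_*ℕ suc (2 *ℕ n)) (∏odd<-suc-even (ℕ∣.m∣m*n n)) ⟩
  ∏odd< (2 *ℕ n) *ℕ suc (2 *ℕ n) ∎

2∤∏odd< : ∀ n → ¬ 2 ℕ∣.∣ ∏odd< n
2∤∏odd< zero = 2∤1+2n 0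
2∤∏odd< (suc n) with 2 ℕ∣.∣? n
... | yes 2∣n = subst (λ k → ¬ 2 ℕ∣.∣ k) (sym (∏odd<-suc-even 2∣n)) (2∤∏odd< n)
... | no  2∤n = subst (λ k → ¬ 2 ℕ∣.∣ k) (sym (∏odd<-suc-odd 2∤n)) (2∤m*n (2∤∏odd< n) 2∤n)

-- The even factors 2, 4, ..., 2n contribute 2^n n!, and the odd ones make up the last factor.
[2n]!≡ : ∀ n → (2 *ℕ n) ! ≡ 2 ℕ.^ n *ℕ n ! *ℕ ∏odd< (2 *ℕ n)
[2n]!≡ zero = refl
[2n]!≡ (suc n) = begin
  (2 *ℕ suc n) !
    ≡⟨ cong _! (ℕ.*-suc 2 n) ⟩
  suc (suc (2 *ℕ n)) *ℕ (suc (2 *ℕ n) *ℕ (2 *ℕ n) !)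
    ≡⟨ cong (λ k → suc (suc (2 *ℕ n)) *ℕ (suc (2 *ℕ n) *ℕ k)) ([2n]!≡ n) ⟩
  suc (suc (2 *ℕ n)) *ℕ (suc (2 *ℕ n) *ℕ (2 ℕ.^ n *ℕ n ! *ℕ ∏odd< (2 *ℕ n)))
    ≡⟨ solve 4 (λ m p f o → (con 2 :+ con 2 :* m) :* ((con 1 :+ con 2 :* m) :* (p :* f :* o))
         := (con 2 :* p) :* ((con 1 :+ m) :* f) :* (o :* (con 1 :+ con 2 :* m))) refl
         n (2 ℕ.^ n) (n !) (∏odd< (2 *ℕ n)) ⟩
  2 ℕ.^ suc n *ℕ suc n ! *ℕ (∏odd< (2 *ℕ n) *ℕ suc (2 *ℕ n))
    ≡⟨ cong (2 ℕ.^ suc n *ℕ suc n ! *ℕ_) (∏odd<-2*suc n) ⟨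
  2 ℕ.^ suc n *ℕ suc n ! *ℕ ∏odd< (2 *ℕ suc n)
    ∎
  where open ℕSolver.+-*-Solver

-- In `[2n]!≡` at n = 2^e the powers of 2 merge into one and the remaining factors are odd, so
-- `od-unique` reads off the odd part.
od[2^suc!] : ∀ e → od[2^ suc e !] ≡ od[2^ e !] *ℕ [2^ suc e -1]!!
od[2^suc!] e with od-spec ((2 ℕ.^ e) !) {{(2 ℕ.^ e) ℕ.!≢0}}
... | 2∤od , eq = od-unique ((2 ℕ.^ suc e) !) {{(2 ℕ.^ suc e) ℕ.!≢0}} (2 ℕ.^ e +ℕ k)
  (2∤m*n 2∤od (2∤∏odd< (2 ℕ.^ suc e))) (begin
    (2 ℕ.^ suc e) !
      ≡⟨ [2n]!≡ (2 ℕ.^ e) ⟩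
    2 ℕ.^ (2 ℕ.^ e) *ℕ (2 ℕ.^ e) ! *ℕ [2^ suc e -1]!!
      ≡⟨ cong (λ m → 2 ℕ.^ (2 ℕ.^ e) *ℕ m *ℕ [2^ suc e -1]!!) eq ⟩
    2 ℕ.^ (2 ℕ.^ e) *ℕ (2 ℕ.^ k *ℕ od[2^ e !]) *ℕ [2^ suc e -1]!!
      ≡⟨ solve 4 (λ a b c d → a :* (b :* c) :* d := (a :* b) :* (c :* d)) refl
           (2 ℕ.^ (2 ℕ.^ e)) (2 ℕ.^ k) od[2^ e !] [2^ suc e -1]!! ⟩
    2 ℕ.^ (2 ℕ.^ e) *ℕ 2 ℕ.^ k *ℕ (od[2^ e !] *ℕ [2^ suc e -1]!!)
      ≡⟨ cong (_*ℕ (od[2^ e !] *ℕ [2^ suc e -1]!!)) (ℕ.^-distribˡ-+-* 2 (2 ℕ.^ e) k) ⟨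
    2 ℕ.^ (2 ℕ.^ e +ℕ k) *ℕ (od[2^ e !] *ℕ [2^ suc e -1]!!)
      ∎)
  where
  open ℕSolver.+-*-Solver
  k = ν ((2 ℕ.^ e) !) {{(2 ℕ.^ e) ℕ.!≢0}}

-- With consecutive odd factors paired, shifting each pair (4j+1)(4j+3) by 4n
-- does not change it modulo 8n; hence (2^{e+1} − 1)!! ≡ ((2^e − 1)!!)² modulo 2^{e+1}.
∏pairs : ℕ → ℕ
∏pairs zero    = 1
∏pairs (suc j) = ∏pairs j *ℕ (suc (4 *ℕ j) *ℕ (3 +ℕ 4 *ℕ j))

∏odd<-4* : ∀ n → ∏odd< (4 *ℕ n) ≡ ∏pairs n
∏odd<-4* n = trans (cong ∏odd<_ (4*n≡ n)) (go n)
  where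
  open ℕSolver.+-*-Solver
  4*n≡ : ∀ n → 4 *ℕ n ≡ 2 *ℕ (2 *ℕ n)
  4*n≡ = solve 1 (λ n → con 4 :* n := con 2 :* (con 2 :* n)) refl
  go : ∀ n → ∏odd< (2 *ℕ (2 *ℕ n)) ≡ ∏pairs n
  go zero = refl
  go (suc n) = begin
    ∏odd< (2 *ℕ (2 *ℕ suc n))
      ≡⟨ cong (λ k → ∏odd< (2 *ℕ k)) (ℕ.*-suc 2 n) ⟩
    ∏odd< (2 *ℕ suc (suc (2 *ℕ n)))
      ≡⟨ ∏odd<-2*suc (suc (2 *ℕ n)) ⟩
    ∏odd< (2 *ℕ suc (2 *ℕ n)) *ℕ suc (2 *ℕ suc (2 *ℕ n))
      ≡⟨ cong (_*ℕ suc (2 *ℕ suc (2 *ℕ n))) (trans (∏odd<-2*suc (2 *ℕ n))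
           (cong (_*ℕ suc (2 *ℕ (2 *ℕ n))) (go n))) ⟩
    ∏pairs n *ℕ suc (2 *ℕ (2 *ℕ n)) *ℕ suc (2 *ℕ suc (2 *ℕ n))
      ≡⟨ solve 2 (λ p n →
           p :* (con 1 :+ con 2 :* (con 2 :* n)) :* (con 1 :+ con 2 :* (con 1 :+ con 2 :* n))
           := p :* ((con 1 :+ con 4 :* n) :* (con 3 :+ con 4 :* n))) refl (∏pairs n) n ⟩
    ∏pairs (suc n)
      ∎

∏pairs-+ : ∀ n j → ∃[ t ] ∏pairs (n +ℕ j) ≡ ∏pairs n *ℕ ∏pairs j +ℕ 8 *ℕ n *ℕ t
∏pairs-+ n zero = 0 , (begin
  ∏pairs (n +ℕ 0)                     ≡⟨ cong ∏pairs (ℕ.+-identityʳ n) ⟩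
  ∏pairs n                            ≡⟨ solve 2 (λ p n → p := p :* con 1 :+ con 8 :* n :* con 0)
                                           refl (∏pairs n) n ⟩
  ∏pairs n *ℕ 1 +ℕ 8 *ℕ n *ℕ 0        ∎)
  where open ℕSolver.+-*-Solver
∏pairs-+ n (suc j) with ∏pairs-+ n j
... | t , eq = t′ , (begin
  ∏pairs (n +ℕ suc j)
    ≡⟨ cong ∏pairs (ℕ.+-suc n j) ⟩
  ∏pairs (n +ℕ j) *ℕ (suc (4 *ℕ (n +ℕ j)) *ℕ (3 +ℕ 4 *ℕ (n +ℕ j)))
    ≡⟨ cong (_*ℕ (suc (4 *ℕ (n +ℕ j)) *ℕ (3 +ℕ 4 *ℕ (n +ℕ j)))) eq ⟩
  (∏pairs n *ℕ ∏pairs j +ℕ 8 *ℕ n *ℕ t) *ℕ (suc (4 *ℕ (n +ℕ j)) *ℕ (3 +ℕ 4 *ℕ (n +ℕ j)))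
    ≡⟨ solve 5 (λ p q n j t →
         (p :* q :+ con 8 :* n :* t) :* ((con 1 :+ con 4 :* (n :+ j)) :* (con 3 :+ con 4 :* (n :+ j)))
         := p :* (q :* ((con 1 :+ con 4 :* j) :* (con 3 :+ con 4 :* j))) :+ con 8 :* n :*
           (t :* ((con 1 :+ con 4 :* (n :+ j)) :* (con 3 :+ con 4 :* (n :+ j)))
             :+ p :* q :* (con 4 :* j :+ con 2 :+ con 2 :* n)))
         refl (∏pairs n) (∏pairs j) n j t ⟩
  ∏pairs n *ℕ ∏pairs (suc j) +ℕ 8 *ℕ n *ℕ t′
    ∎)
  where
  open ℕSolver.+-*-Solver
  -- The first summand carries the old error through the new pair. In the second, 4j + 2 + 2n is the
  -- change of (4j+1)(4j+3) under the shift by 4n, divided by 8n.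
  t′ = t *ℕ (suc (4 *ℕ (n +ℕ j)) *ℕ (3 +ℕ 4 *ℕ (n +ℕ j)))
         +ℕ ∏pairs n *ℕ ∏pairs j *ℕ (4 *ℕ j +ℕ 2 +ℕ 2 *ℕ n)

-- With n = 2^(k+1) the product is (4n - 1)!!, so this is (2^e - 1)!! ≡ 1 modulo 2^e for e = k + 3.
-- Doubling n squares the product up to a multiple of 8n, and the square of 1 + 4ns is 1 modulo 8n.
∏pairs-2^ : ∀ k → ∃[ t ] ∏pairs (2 ℕ.^ suc k) ≡ 1 +ℕ 4 *ℕ 2 ℕ.^ suc k *ℕ t
-- Here 1 · 3 · 5 · 7 = 105 = 1 + 8 · 13. One step earlier the congruence fails, since 1 · 3 is not
-- 1 modulo 4.
∏pairs-2^ zero = 13 , refl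
∏pairs-2^ (suc k) with ∏pairs-2^ k | ∏pairs-+ (2 ℕ.^ suc k) (2 ℕ.^ suc k)
... | s , eq | t , eq₂ = s +ℕ 2 *ℕ n *ℕ s *ℕ s +ℕ t , (begin
  ∏pairs (2 *ℕ n)
    ≡⟨ cong (λ m → ∏pairs (n +ℕ m)) (ℕ.+-identityʳ n) ⟩
  ∏pairs (n +ℕ n)
    ≡⟨ eq₂ ⟩
  ∏pairs n *ℕ ∏pairs n +ℕ 8 *ℕ n *ℕ t
    ≡⟨ cong (λ p → p *ℕ p +ℕ 8 *ℕ n *ℕ t) eq ⟩
  (1 +ℕ 4 *ℕ n *ℕ s) *ℕ (1 +ℕ 4 *ℕ n *ℕ s) +ℕ 8 *ℕ n *ℕ t
    ≡⟨ solve 3 (λ n s t →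
         (con 1 :+ con 4 :* n :* s) :* (con 1 :+ con 4 :* n :* s) :+ con 8 :* n :* t
         := con 1 :+ con 4 :* (con 2 :* n) :* (s :+ con 2 :* n :* s :* s :+ t)) refl n s t ⟩
  1 +ℕ 4 *ℕ (2 *ℕ n) *ℕ (s +ℕ 2 *ℕ n *ℕ s *ℕ s +ℕ t)
    ∎)
  where
  open ℕSolver.+-*-Solver
  n = 2 ℕ.^ suc k

-- The number w_e, written exactly as the fraction in `Is-w` so that the two agree by definition.
quotient-w : ℕ → ℕ
quotient-w e = ([2^ e -1]!! ℕ.∸ 1) ℕ./ 2 ℕ.^ e
  where instance _ = ℕ.m^n≢0 2 e

-- Both truncating operations in `quotient-w` are exact, because `∏pairs-2^` exhibits the double
-- factorial as 1 plus a multiple of 4 · 2^(k+1) = 2^e, where e = k + 3.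
[2^e-1]!!≡1+2^e*quotient-w : ∀ e → 3 ≤ e → [2^ e -1]!! ≡ 1 +ℕ 2 ℕ.^ e *ℕ quotient-w e
[2^e-1]!!≡1+2^e*quotient-w (suc (suc (suc k))) (s≤s (s≤s (s≤s z≤n))) with ∏pairs-2^ k
... | t , eq = trans !!≡ (cong (λ u → 1 +ℕ 2 ℕ.^ e *ℕ u) (sym quotient≡t))
  where
  e = 3 +ℕ k
  instance _ = ℕ.m^n≢0 2 e
  2^e≡ : 2 ℕ.^ e ≡ 4 *ℕ 2 ℕ.^ suc k
  2^e≡ = sym (ℕ.*-assoc 2 2 (2 ℕ.^ suc k))
  !!≡ : [2^ e -1]!! ≡ 1 +ℕ 2 ℕ.^ e *ℕ t
  !!≡ = begin
    ∏odd< (2 ℕ.^ e)            ≡⟨ cong ∏odd<_ 2^e≡ ⟩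
    ∏odd< (4 *ℕ 2 ℕ.^ suc k)   ≡⟨ ∏odd<-4* (2 ℕ.^ suc k) ⟩
    ∏pairs (2 ℕ.^ suc k)       ≡⟨ eq ⟩
    1 +ℕ 4 *ℕ 2 ℕ.^ suc k *ℕ t ≡⟨ cong (λ m → 1 +ℕ m *ℕ t) 2^e≡ ⟨
    1 +ℕ 2 ℕ.^ e *ℕ t          ∎
  quotient≡t : quotient-w e ≡ t
  quotient≡t = begin
    ([2^ e -1]!! ℕ.∸ 1) ℕ./ 2 ℕ.^ e ≡⟨ ℕ./-congˡ (cong (ℕ._∸ 1) !!≡) ⟩
    (2 ℕ.^ e *ℕ t) ℕ./ 2 ℕ.^ e      ≡⟨ ℕ./-congˡ (ℕ.*-comm (2 ℕ.^ e) t) ⟩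
    (t *ℕ 2 ℕ.^ e) ℕ./ 2 ℕ.^ e      ≡⟨ ℕ.m*n/n≡m t (2 ℕ.^ e) ⟩
    t                                ∎

-- Congruences modulo powers of 2

infix 4 _≅_mod2^_

-- Unlike _≡ℤ_mod2^_, which unfolds to a divisibility, this wrapper lets a, b
-- and n be inferred from the type of a congruence.
record _≅_mod2^_ (a b : ℤ) (n : ℕ) : Set where
  constructor congruent
  field divisible : a ≡ℤ b mod2^ n

open _≅_mod2^_

mod-reflexive : ∀ {n a b} → a ≡ b → a ≅ b mod2^ n
mod-reflexive {n} {a} refl = congruent (divides (+ 0) (ℤ.+-inverseʳ a))

mod-sym : ∀ {n a b} → a ≅ b mod2^ n → b ≅ a mod2^ n
mod-sym {n} {a} {b} p = congruent (subst (+ (2 ℕ.^ n) ∣ℤ_)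
  (solve 2 (λ a b → :- (a :- b) := b :- a) refl a b) (∣m⇒∣-m (divisible p)))
  where open +-*-Solver

mod-trans : ∀ {n a b c} → a ≅ b mod2^ n → b ≅ c mod2^ n → a ≅ c mod2^ n
mod-trans {n} {a} {b} {c} p q = congruent (subst (+ (2 ℕ.^ n) ∣ℤ_)
  (solve 3 (λ a b c → (a :- b) :+ (b :- c) := a :- c) refl a b c) (∣m∣n⇒∣m+n (divisible p) (divisible q)))
  where open +-*-Solver

mod-- : ∀ {n a b c d} → a ≅ b mod2^ n → c ≅ d mod2^ n → a ℤ.- c ≅ b ℤ.- d mod2^ n
mod-- {n} {a} {b} {c} {d} p q = congruent (subst (+ (2 ℕ.^ n) ∣ℤ_)
  (solve 4 (λ a b c d → (a :- b) :+ (:- (c :- d)) := (a :- c) :- (b :- d)) refl a b c d)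
  (∣m∣n⇒∣m+n (divisible p) (∣m⇒∣-m (divisible q))))
  where open +-*-Solver

mod-* : ∀ {n a b c d} → a ≅ b mod2^ n → c ≅ d mod2^ n → a ℤ.* c ≅ b ℤ.* d mod2^ n
mod-* {n} {a} {b} {c} {d} p q = congruent (subst (+ (2 ℕ.^ n) ∣ℤ_)
  (solve 4 (λ a b c d → (a :- b) :* c :+ (c :- d) :* b := a :* c :- b :* d) refl a b c d)
  (∣m∣n⇒∣m+n (∣m⇒∣m*n c (divisible p)) (∣m⇒∣m*n b (divisible q))))
  where open +-*-Solver

mod-neg : ∀ {n a b} → a ≅ b mod2^ n → ℤ.- a ≅ ℤ.- b mod2^ n
mod-neg {n} {a} {b} p = congruent (subst (+ (2 ℕ.^ n) ∣ℤ_)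
  (solve 2 (λ a b → :- (a :- b) := (:- a) :- (:- b)) refl a b) (∣m⇒∣-m (divisible p)))
  where open +-*-Solver

+2^-+ : ∀ m n → + (2 ℕ.^ (m +ℕ n)) ≡ + (2 ℕ.^ m) ℤ.* + (2 ℕ.^ n)
+2^-+ m n = trans (cong +_ (ℕ.^-distribˡ-+-* 2 m n)) (ℤ.pos-* (2 ℕ.^ m) (2 ℕ.^ n))

mod-weaken : ∀ {m n a b} → m ≤ n → a ≅ b mod2^ n → a ≅ b mod2^ m
mod-weaken {m} {n} m≤n p = congruent (∣-trans (divides (+ (2 ℕ.^ (n ℕ.∸ m)))
  (trans (cong (λ k → + (2 ℕ.^ k)) (sym (ℕ.m∸n+n≡m m≤n))) (+2^-+ (n ℕ.∸ m) m))) (divisible p))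

approx-mod : ∀ x {m n} → m ≤ n → approx x n ≅ approx x m mod2^ m
approx-mod x {m} m≤n = subst (λ k → approx x k ≅ approx x m mod2^ m) (ℕ.m∸n+n≡m m≤n) (go _)
  where
  go : ∀ k → approx x (k +ℕ m) ≅ approx x m mod2^ m
  go zero    = mod-reflexive refl
  go (suc k) = mod-trans (mod-weaken (ℕ.m≤n+m m k) (congruent (coherent x (k +ℕ m)))) (go k)

-- Least nonnegative residues modulo powers of 2

infixl 7 _%2^_
_%2^_ : ℤ → ℕ → ℕ
a %2^ n = a ℤ.%ℕ 2 ℕ.^ n
  where instance _ = ℕ.m^n≢0 2 n

%2^<2^ : ∀ a n → a %2^ n < 2 ℕ.^ n
%2^<2^ a n = ℤ.n%ℕd<d a (2 ℕ.^ n) {{ℕ.m^n≢0 2 n}}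

%2^-mod : ∀ a n → + (a %2^ n) ≅ a mod2^ n
%2^-mod a n = mod-sym (congruent (divides (a ℤ./ℕ 2 ℕ.^ n) (begin
  a ℤ.- r                   ≡⟨ cong (ℤ._- r) (ℤ.a≡a%ℕn+[a/ℕn]*n a (2 ℕ.^ n)) ⟩
  r ℤ.+ q ℤ.- r             ≡⟨ solve 2 (λ r q → r :+ q :- r := q) refl r q ⟩
  q                         ∎)))
  where
  open +-*-Solver
  instance _ = ℕ.m^n≢0 2 n
  r = + (a ℤ.%ℕ 2 ℕ.^ n)
  q = (a ℤ./ℕ 2 ℕ.^ n) ℤ.* + (2 ℕ.^ n)

-- The difference is a multiple of 2^n of absolute value below 2^n, hence zero.
mod⇒≡ : ∀ {n r s} → r < 2 ℕ.^ n → s < 2 ℕ.^ n → + r ≅ + s mod2^ n → r ≡ s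
mod⇒≡ {n} {r} {s} r< s< p with ℤ.∣ + r ℤ.- + s ∣ in eq
... | zero = ℤ.+-injective (ℤ.i-j≡0⇒i≡j (+ r) (+ s) (ℤ.∣i∣≡0⇒i≡0 eq))
... | suc k = contradiction
  (ℕ∣.∣⇒≤ (subst (2 ℕ.^ n ℕ∣.∣_) eq (∣⇒∣ᵤ (divisible p))))
  (ℕ.<⇒≱ (subst (_< 2 ℕ.^ n) eq (ℕ.≤-<-trans
    (subst (λ i → ℤ.∣ i ∣ ≤ r ℕ.⊔ s) (sym (ℤ.m-n≡m⊖n r s)) (ℤ.∣m⊝n∣≤m⊔n r s))
    (ℕ.⊔-lub r< s<))))

%2^-cong : ∀ {n a b} → a ≅ b mod2^ n → a %2^ n ≡ b %2^ n
%2^-cong {n} {a} {b} p = mod⇒≡ (%2^<2^ a n) (%2^<2^ b n)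
  (mod-trans (%2^-mod a n) (mod-trans p (mod-sym (%2^-mod b n))))

-- Binary digits

-- The recurrence for `r` telescopes over the positions k, ..., k + d - 1. Digits and residues are
-- arbitrary functions, so one induction serves both the natural number read by `uns` and the 2-adic
-- integer read by `stab`.
sum-digits : ∀ (b r : ℕ → ℕ) → (∀ j → r (suc j) ≡ r j +ℕ 2 ℕ.^ j *ℕ b j) → ∀ k d →
  2 ℕ.^ k *ℕ sum (map (λ i → b (k +ℕ i) *ℕ 2 ℕ.^ i) (upTo d)) +ℕ r k ≡ r (k +ℕ d)
sum-digits b r r-suc k zero = begin
  2 ℕ.^ k *ℕ 0 +ℕ r k ≡⟨ cong (_+ℕ r k) (ℕ.*-zeroʳ (2 ℕ.^ k)) ⟩
  r k                 ≡⟨ cong r (ℕ.+-identityʳ k) ⟨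
  r (k +ℕ 0)          ∎
sum-digits b r r-suc k (suc d) = begin
  2 ℕ.^ k *ℕ sum (map f (upTo (suc d))) +ℕ r k
    ≡⟨ cong (λ l → 2 ℕ.^ k *ℕ sum (map f l) +ℕ r k) (upTo-∷ʳ d) ⟨
  2 ℕ.^ k *ℕ sum (map f (upTo d ++ d ∷ [])) +ℕ r k
    ≡⟨ cong (λ l → 2 ℕ.^ k *ℕ sum l +ℕ r k) (map-++ f (upTo d) (d ∷ [])) ⟩
  2 ℕ.^ k *ℕ sum (map f (upTo d) ++ f d ∷ []) +ℕ r k
    ≡⟨ cong (λ s → 2 ℕ.^ k *ℕ s +ℕ r k) (sum-++ (map f (upTo d)) (f d ∷ [])) ⟩
  2 ℕ.^ k *ℕ (s +ℕ (b (k +ℕ d) *ℕ 2 ℕ.^ d +ℕ 0)) +ℕ r k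
    ≡⟨ solve 5 (λ p q s c r → p :* (s :+ (c :* q :+ con 0)) :+ r := (p :* s :+ r) :+ (p :* q) :* c)
         refl (2 ℕ.^ k) (2 ℕ.^ d) s (b (k +ℕ d)) (r k) ⟩
  2 ℕ.^ k *ℕ s +ℕ r k +ℕ 2 ℕ.^ k *ℕ 2 ℕ.^ d *ℕ b (k +ℕ d)
    ≡⟨ cong₂ (λ m p → m +ℕ p *ℕ b (k +ℕ d)) (sum-digits b r r-suc k d)
         (sym (ℕ.^-distribˡ-+-* 2 k d)) ⟩
  r (k +ℕ d) +ℕ 2 ℕ.^ (k +ℕ d) *ℕ b (k +ℕ d)
    ≡⟨ r-suc (k +ℕ d) ⟨
  r (suc (k +ℕ d))
    ≡⟨ cong r (ℕ.+-suc k d) ⟨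
  r (k +ℕ suc d)
    ∎
  where
  open ℕSolver.+-*-Solver
  f = λ i → b (k +ℕ i) *ℕ 2 ℕ.^ i
  s = sum (map f (upTo d))

%2^-suc : ∀ m j → + m %2^ suc j ≡ + m %2^ j +ℕ 2 ℕ.^ j *ℕ bitℕ j m
%2^-suc m j = begin
  r                          ≡⟨ ℕ.m≡m%n+[m/n]*n r M ⟩
  r ℕ.% M +ℕ r ℕ./ M *ℕ M    ≡⟨ cong₂ (λ x y → x +ℕ y *ℕ M)
                                  -- Reducing the residue modulo 2M further modulo M drops its top
                                  -- digit; dividing it by M isolates that digit.
                                  (ℕ.m∣n⇒o%n%m≡o%m M (2 *ℕ M) m (ℕ∣.n∣m*n 2))
                                  (ℕ.m%[n*o]/o≡m/o%n m 2 M) ⟩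
  m ℕ.% M +ℕ bitℕ j m *ℕ M   ≡⟨ cong (m ℕ.% M +ℕ_) (ℕ.*-comm (bitℕ j m) M) ⟩
  m ℕ.% M +ℕ M *ℕ bitℕ j m   ∎
  where
  M = 2 ℕ.^ j
  instance _ = ℕ.m^n≢0 2 j
  instance _ = ℕ.m^n≢0 2 (suc j)
  r = m ℕ.% (2 *ℕ M)

-- Since `bit` reads position j off the residue modulo 2^(j+1), `%2^-suc` applies to that residue,
-- and coherence identifies its reduction modulo 2^j with `residue x j`.
residue-suc : ∀ x j → residue x (suc j) ≡ residue x j +ℕ 2 ℕ.^ j *ℕ bit j x
residue-suc x j = begin
  r                           ≡⟨ mod⇒≡ (%2^<2^ (approx x (suc j)) (suc j)) (%2^<2^ (+ r) (suc j))
                                   (mod-sym (%2^-mod (+ r) (suc j))) ⟩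
  + r %2^ suc j               ≡⟨ %2^-suc r j ⟩
  + r %2^ j +ℕ 2 ℕ.^ j *ℕ bit j x
    ≡⟨ cong (_+ℕ 2 ℕ.^ j *ℕ bit j x) (%2^-cong {j} (mod-trans
         (mod-weaken (ℕ.n≤1+n j) (%2^-mod (approx x (suc j)) (suc j))) (congruent (coherent x j)))) ⟩
  residue x j +ℕ 2 ℕ.^ j *ℕ bit j x ∎
  where r = residue x (suc j)

uns-residue : ∀ e d →
  2 ℕ.^ (e +ℕ 1) *ℕ uns e d +ℕ + od[2^ e !] %2^ (e +ℕ 1) ≡ + od[2^ e !] %2^ (e +ℕ 1 +ℕ d)
uns-residue e d = sum-digits (λ i → bitℕ i od[2^ e !]) (+ od[2^ e !] %2^_)
  (%2^-suc od[2^ e !]) (e +ℕ 1) d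

stab-residue : ∀ z k d → 2 ℕ.^ k *ℕ stab z k d +ℕ residue z k ≡ residue z (k +ℕ d)
stab-residue z = sum-digits (λ i → bit i z) (residue z) (residue-suc z)

-- The limit of the odd parts

-- The factor anticipates, to first order, all factors still to come: 2-adically 2^(f+1) + 2^(f+2) +
-- ... = -2^(f+1). The integer `W` stands for w at a fixed precision while f varies.
damped : ℤ → ℕ → ℤ
damped W f = + od[2^ f !] ℤ.* (+ 1 ℤ.- + (2 ℕ.^ suc f) ℤ.* W)

damped-stable : ∀ w → Is-w w → ∀ e → 3 ≤ e → ∀ j →
  damped (approx w e) (j +ℕ e) ≅ damped (approx w e) e mod2^ (suc e +ℕ e)
damped-stable w w-spec e 3≤e zero    = mod-reflexive refl
damped-stable w w-spec e 3≤e (suc j) = mod-trans step (damped-stable w w-spec e 3≤e j)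
  where
  open +-*-Solver
  f = j +ℕ e
  W = approx w e
  E = + (2 ℕ.^ e)
  c = + (2 ℕ.^ j)
  A = + od[2^ f !]
  v = + quotient-w (suc f)

  -- At index f + 1 the hypothesis on w holds modulo 2^f; of this only 2^e survives, because `W` is
  -- known only to precision e.
  W≡v : W ≅ v mod2^ e
  W≡v = mod-trans (mod-sym (approx-mod w (ℕ.m≤n+m e j)))
    (mod-weaken (ℕ.m≤n+m e j)
      (congruent (w-spec (suc f) (ℕ.≤-trans 3≤e (ℕ.≤-trans (ℕ.m≤n+m e j) (ℕ.n≤1+n f))))))

  q≡ : + (2 ℕ.^ suc f) ≡ + 2 ℤ.* (c ℤ.* E)
  q≡ = trans (+2^-+ 1 f) (cong (+ 2 ℤ.*_) (+2^-+ j e))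

  A-suc : + od[2^ suc f !] ≡ A ℤ.* (+ 1 ℤ.+ + (2 ℕ.^ suc f) ℤ.* v)
  A-suc = begin
    + od[2^ suc f !]
      ≡⟨ cong +_ (od[2^suc!] f) ⟩
    + (od[2^ f !] *ℕ [2^ suc f -1]!!)
      ≡⟨ ℤ.pos-* od[2^ f !] _ ⟩
    A ℤ.* + [2^ suc f -1]!!
      ≡⟨ cong (λ m → A ℤ.* + m) ([2^e-1]!!≡1+2^e*quotient-w (suc f)
           (ℕ.≤-trans 3≤e (ℕ.≤-trans (ℕ.m≤n+m e j) (ℕ.n≤1+n f)))) ⟩
    A ℤ.* (+ 1 ℤ.+ + (2 ℕ.^ suc f *ℕ quotient-w (suc f)))
      ≡⟨ cong (λ i → A ℤ.* (+ 1 ℤ.+ i)) (ℤ.pos-* (2 ℕ.^ suc f) (quotient-w (suc f))) ⟩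
    A ℤ.* (+ 1 ℤ.+ + (2 ℕ.^ suc f) ℤ.* v)
      ∎

  step : damped W (suc f) ≅ damped W f mod2^ (suc e +ℕ e)
  step with W≡v
  ... | congruent (divides t W-v≡tE) = congruent (divides
    -- With q = 2^(f+1) = 2cE and v = W - tE, the difference is A (q (v - W) - 2 q² v W). Both terms
    -- contain 2E² = 2^(2e+1), and the witness is the cofactor.
    (A ℤ.* c ℤ.* (ℤ.- (+ 4 ℤ.* c ℤ.* W ℤ.* W) ℤ.- t ℤ.* (+ 1 ℤ.- + 4 ℤ.* c ℤ.* E ℤ.* W))) (begin
    + od[2^ suc f !] ℤ.* (+ 1 ℤ.- + (2 ℕ.^ suc (suc f)) ℤ.* W)
      ℤ.- A ℤ.* (+ 1 ℤ.- + (2 ℕ.^ suc f) ℤ.* W)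
        ≡⟨ cong₂ (λ x y → x ℤ.* (+ 1 ℤ.- y ℤ.* W) ℤ.- A ℤ.* (+ 1 ℤ.- + (2 ℕ.^ suc f) ℤ.* W))
             A-suc (+2^-+ 1 (suc f)) ⟩
    A ℤ.* (+ 1 ℤ.+ + (2 ℕ.^ suc f) ℤ.* v) ℤ.* (+ 1 ℤ.- + 2 ℤ.* + (2 ℕ.^ suc f) ℤ.* W)
      ℤ.- A ℤ.* (+ 1 ℤ.- + (2 ℕ.^ suc f) ℤ.* W)
        ≡⟨ cong₂ (λ q v → A ℤ.* (+ 1 ℤ.+ q ℤ.* v) ℤ.* (+ 1 ℤ.- + 2 ℤ.* q ℤ.* W)
             ℤ.- A ℤ.* (+ 1 ℤ.- q ℤ.* W)) q≡ v≡ ⟩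
    A ℤ.* (+ 1 ℤ.+ + 2 ℤ.* (c ℤ.* E) ℤ.* (W ℤ.- t ℤ.* E)) ℤ.* (+ 1 ℤ.- + 2 ℤ.* (+ 2 ℤ.* (c ℤ.* E)) ℤ.* W)
      ℤ.- A ℤ.* (+ 1 ℤ.- + 2 ℤ.* (c ℤ.* E) ℤ.* W)
        ≡⟨ solve 5 (λ A c E W t →
             A :* (con (+ 1) :+ con (+ 2) :* (c :* E) :* (W :- t :* E))
               :* (con (+ 1) :- con (+ 2) :* (con (+ 2) :* (c :* E)) :* W)
               :- A :* (con (+ 1) :- con (+ 2) :* (c :* E) :* W)
             := A :* c :* (:- (con (+ 4) :* c :* W :* W) :- t :* (con (+ 1) :- con (+ 4) :* c :* E :* W))
               :* ((con (+ 2) :* E) :* E)) refl A c E W t ⟩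
    A ℤ.* c ℤ.* (ℤ.- (+ 4 ℤ.* c ℤ.* W ℤ.* W) ℤ.- t ℤ.* (+ 1 ℤ.- + 4 ℤ.* c ℤ.* E ℤ.* W))
      ℤ.* ((+ 2 ℤ.* E) ℤ.* E)
        ≡⟨ cong (A ℤ.* c ℤ.* (ℤ.- (+ 4 ℤ.* c ℤ.* W ℤ.* W) ℤ.- t ℤ.* (+ 1 ℤ.- + 4 ℤ.* c ℤ.* E ℤ.* W)) ℤ.*_)
             (trans (+2^-+ (suc e) e) (cong (ℤ._* E) (+2^-+ 1 e))) ⟨
    A ℤ.* c ℤ.* (ℤ.- (+ 4 ℤ.* c ℤ.* W ℤ.* W) ℤ.- t ℤ.* (+ 1 ℤ.- + 4 ℤ.* c ℤ.* E ℤ.* W))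
      ℤ.* + (2 ℕ.^ (suc e +ℕ e)) ∎))
    where
    v≡ : v ≡ W ℤ.- t ℤ.* E
    v≡ = trans (solve 2 (λ v W → v := W :- (W :- v)) refl v W) (cong (λ i → W ℤ.- i) W-v≡tE)

z≡damped : ∀ z w → Is-z z → Is-w w → ∀ e → 3 ≤ e →
  approx z (suc e +ℕ e) ≅ damped (approx w e) e mod2^ (suc e +ℕ e)
z≡damped z w z-lim w-spec e 3≤e with z-lim (suc e +ℕ e)
... | N , near = mod-trans
  (mod-sym (congruent (near f (ℕ.≤-trans (ℕ.m≤m+n N e) (ℕ.m≤m+n (N +ℕ e) e)))))
  (mod-trans A≡damped (damped-stable w w-spec e 3≤e (N +ℕ e)))
  where
  open +-*-Solver
  -- This index is at least N, so a_f ≡ z; it is at least 2e, so the term with 2^(f+1) vanishes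
  -- modulo 2^(2e+1); and it has the form j + e, with j = N + e, that `damped-stable` expects.
  f = N +ℕ e +ℕ e
  A = + od[2^ f !]
  W = approx w e
  A≡damped : A ≅ damped W f mod2^ (suc e +ℕ e)
  A≡damped = congruent (divides (A ℤ.* W ℤ.* + (2 ℕ.^ N)) (begin
    A ℤ.- A ℤ.* (+ 1 ℤ.- + (2 ℕ.^ suc f) ℤ.* W)
      ≡⟨ solve 3 (λ A q W → A :- A :* (con (+ 1) :- q :* W) := A :* W :* q)
           refl A (+ (2 ℕ.^ suc f)) W ⟩
    A ℤ.* W ℤ.* + (2 ℕ.^ suc f)
      ≡⟨ cong (λ k → A ℤ.* W ℤ.* + (2 ℕ.^ k))
           (trans (cong suc (ℕ.+-assoc N e e)) (sym (ℕ.+-suc N (e +ℕ e)))) ⟩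
    A ℤ.* W ℤ.* + (2 ℕ.^ (N +ℕ (suc e +ℕ e)))
      ≡⟨ cong (A ℤ.* W ℤ.*_) (+2^-+ N (suc e +ℕ e)) ⟩
    A ℤ.* W ℤ.* (+ (2 ℕ.^ N) ℤ.* + (2 ℕ.^ (suc e +ℕ e)))
      ≡⟨ ℤ.*-assoc (A ℤ.* W) (+ (2 ℕ.^ N)) _ ⟨
    A ℤ.* W ℤ.* + (2 ℕ.^ N) ℤ.* + (2 ℕ.^ (suc e +ℕ e))
      ∎))

-- Comparison of digits and the value of K

-- Modulo 2^(e+1+d) the difference z - a_e is -2^(e+1) a_e w. The digits below position e + 1
-- cancel, division by 2^(e+1) leaves -a_e w modulo 2^d, and there a_e may be replaced by z.
stab-uns : ∀ z w → Is-z z → Is-w w → ∀ e d → 3 ≤ e → d < e →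
  + stab z (e +ℕ 1) d ℤ.- + uns e d ≅ ℤ.- (approx z d ℤ.* approx w d) mod2^ d
stab-uns z w z-lim w-spec e d 3≤e d<e =
  mod-trans scaled (mod-neg (mod-* (mod-trans (mod-sym (mod-weaken d≤k zₙ≡a)) (approx-mod z d≤n))
    (approx-mod w (ℕ.<⇒≤ d<e))))
  where
  open +-*-Solver
  k = e +ℕ 1
  n = k +ℕ d
  a = + od[2^ e !]
  W = approx w e
  q = + (2 ℕ.^ k)
  S = + stab z k d
  U = + uns e d

  k≡ : k ≡ suc e
  k≡ = ℕ.+-comm e 1
  d≤k : d ≤ k
  d≤k = ℕ.≤-trans (ℕ.<⇒≤ d<e) (ℕ.m≤m+n e 1)
  d≤n : d ≤ n
  d≤n = ℕ.m≤n+m d k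
  -- The bound on d keeps all digits that are read within the precision 2^(2e+1) of `z≡damped`.
  n≤ : n ≤ suc e +ℕ e
  n≤ = ℕ.+-mono-≤ (ℕ.≤-reflexive k≡) (ℕ.<⇒≤ d<e)

  zₙ-a : approx z n ℤ.- a ≅ q ℤ.* (ℤ.- (a ℤ.* W)) mod2^ n
  zₙ-a = mod-trans
    (mod-- (mod-trans (mod-sym (approx-mod z n≤)) (mod-weaken n≤ (z≡damped z w z-lim w-spec e 3≤e)))
           (mod-reflexive refl))
    (mod-reflexive (trans (cong (λ i → a ℤ.* (+ 1 ℤ.- + (2 ℕ.^ i) ℤ.* W) ℤ.- a) (sym k≡))
      (solve 3 (λ a q W → a :* (con (+ 1) :- q :* W) :- a := q :* (:- (a :* W))) refl a q W)))

  zₙ≡a : approx z n ≅ a mod2^ k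
  zₙ≡a = congruent (subst (q ∣ℤ_)
    (solve 3 (λ x a y → (x :- a :- y) :+ y := x :- a) refl
      (approx z n) a (q ℤ.* (ℤ.- (a ℤ.* W))))
    (∣m∣n⇒∣m+n (divisible (mod-weaken (ℕ.m≤m+n k d) zₙ-a)) (divides (ℤ.- (a ℤ.* W)) (ℤ.*-comm q _))))

  -- The low parts are equal as numbers, not merely congruent, so no borrow reaches position e + 1
  -- when they are subtracted.
  residue≡ : residue z k ≡ a %2^ k
  residue≡ = %2^-cong {k} (mod-trans (mod-sym (approx-mod z (ℕ.m≤m+n k d))) zₙ≡a)

  q[S-U]≡ : q ℤ.* (S ℤ.- U) ≡ + residue z n ℤ.- + (a %2^ n)
  q[S-U]≡ = begin
    q ℤ.* (S ℤ.- U)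
      ≡⟨ solve 4 (λ q S U r → q :* (S :- U) := (q :* S :+ r) :- (q :* U :+ r)) refl
           q S U (+ residue z k) ⟩
    (q ℤ.* S ℤ.+ + residue z k) ℤ.- (q ℤ.* U ℤ.+ + residue z k)
      ≡⟨ cong (λ r → (q ℤ.* S ℤ.+ + residue z k) ℤ.- (q ℤ.* U ℤ.+ + r)) residue≡ ⟩
    (q ℤ.* S ℤ.+ + residue z k) ℤ.- (q ℤ.* U ℤ.+ + (a %2^ k))
      ≡⟨ cong₂ (λ x y → (x ℤ.+ + residue z k) ℤ.- (y ℤ.+ + (a %2^ k)))
           (ℤ.pos-* (2 ℕ.^ k) (stab z k d)) (ℤ.pos-* (2 ℕ.^ k) (uns e d)) ⟨
    + (2 ℕ.^ k *ℕ stab z k d +ℕ residue z k) ℤ.- + (2 ℕ.^ k *ℕ uns e d +ℕ a %2^ k)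
      ≡⟨ cong₂ (λ x y → + x ℤ.- + y) (stab-residue z k d) (uns-residue e d) ⟩
    + residue z n ℤ.- + (a %2^ n)
      ∎

  scaled : S ℤ.- U ≅ ℤ.- (a ℤ.* W) mod2^ d
  -- Cancelling the common factor 2^(e+1) lowers the modulus from 2^(e+1+d) to 2^d.
  scaled = congruent (*-cancelˡ-∣ q {{ℕ.m^n≢0 2 k}} (subst₂ _∣ℤ_ (+2^-+ k d)
    (solve 3 (λ q x y → q :* x :- q :* y := q :* (x :- y)) refl q (S ℤ.- U) (ℤ.- (a ℤ.* W)))
    (divisible (mod-trans (mod-reflexive q[S-U]≡)
      (mod-trans (mod-- (%2^-mod (approx z n) n) (%2^-mod a n)) zₙ-a)))))

theorem2p11 : (z w : ℤ₂) → Is-z z → Is-w w → (K : ℤ₂) →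
    (∀ d e → 0 < d → d < e → fromℕ (uns e d) + K ≡ fromℕ (stab z (e +ℕ 1) d) mod2^ d) →
    K ≈ - (z * w)
theorem2p11 z w z-lim w-spec K K-spec zero =
  -- The hypothesis on K speaks of positive d; modulo 2^0 = 1 every difference is a multiple of the
  -- modulus, with itself as quotient.
  divides (approx K 0 ℤ.- approx (- (z * w)) 0) (sym (ℤ.*-identityʳ _))
theorem2p11 z w z-lim w-spec K K-spec d@(suc _) =
  divisible (mod-trans K≡S-U (stab-uns z w z-lim w-spec e d (ℕ.m≤m+n 3 d) d<e))
  where
  open +-*-Solver
  -- One value of e suffices for each d; this one satisfies both d < e and 3 ≤ e.
  e = 3 +ℕ d
  d<e : d < e
  d<e = s≤s (ℕ.m≤n+m d 2)
  K≡S-U : approx K d ≅ + stab z (e +ℕ 1) d ℤ.- + uns e d mod2^ d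
  K≡S-U = congruent (subst (+ (2 ℕ.^ d) ∣ℤ_)
    (solve 3 (λ U K S → (U :+ K) :- S := K :- (S :- U)) refl
      (+ uns e d) (approx K d) (+ stab z (e +ℕ 1) d))
    (K-spec d e (s≤s z≤n) d<e))
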